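{- Let $a$ and $b$ be coprime positive integers. Let $m_0,m_1,m_2,\ldots,m_a$ be nonnegative integers such that $\sum_{i=0}^a i\,m_i=a$ and $\sum_{i=0}^a m_i=b$. Then the number of $(a,b)$-Dyck paths having exactly $m_i$ vertical runs of length $i$ for every $0\le i\le a$ is $$\frac{1}{b}\binom{b}{m_0,m_1,\ldots,m_a}=\frac{(b-1)!}{m_0!\,m_1!\cdots m_a!}.$$
   Context: A word in $\{N,E\}^{a+b}$ with $a$ letters $N$ and $b$ letters $E$ is viewed as a lattice path in $\mathbb{Z}^2$ from $(0,0)$ to $(b,a)$, reading left to right, where $N$ is a unit north step and $E$ is a unit east step. Such a word is an $(a,b)$-Dyck path if the path stays weakly above the line $y=\frac{a}{b}x$. (An $(a,b)$-Dyck path always ends in an east step.) A vertical run of length $i\ge 0$ in a path is an occurrence of a subword of consecutive letters $N^iE$ that either starts at the beginning of the whole word or is immediately preceded by a letter $E$. Thus a path ending in $E$ has exactly $b$ vertical runs, one for each east step (runs of length $0$ are counted). $\binom{b}{m_0,\ldots,m_a}=\frac{b!}{m_0!\cdots m_a!}$ is the multinomial coefficient. -}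

module Defs where

open import Data.Fin.Base using (Fin; toℕ)
open import Data.Integer.Base using (+_)
open import Data.List.Base using (List; []; _∷_; _∷ʳ_; filter; inits; last; length; replicate; tabulate; tails; zip)
open import Data.List.Membership.Propositional using (_∈_)
open import Data.List.Properties using (≡-dec)
open import Data.List.Relation.Binary.Prefix.Heterogeneous using (Prefix)
open import Data.List.Relation.Binary.Prefix.Heterogeneous.Properties using (prefix?)
open import Data.List.Relation.Unary.All using (All)
open import Data.List.Relation.Unary.All.Properties using (tabulate⁺)
open import Data.List.Relation.Unary.Unique.Propositional using (Unique)
open import Data.Maybe.Base using (just)
import Data.Maybe.Properties as Maybe
open import Data.Nat.Base using (ℕ; suc; _*_; _≤_; _!; NonZero)
open import Data.Nat.ListAction using (sum; product)
open import Data.Nat.ListAction.Properties using (product≢0)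
open import Data.Nat.Properties using (_!≢0)
open import Data.Product.Base using (_×_; _,_; Σ-syntax)
open import Data.Rational.Base using (ℚ; _/_)
open import Data.Sum.Base using (_⊎_)
open import Function.Bundles using (_⇔_)
open import Relation.Binary.Definitions using (DecidableEquality)
open import Relation.Binary.PropositionalEquality using (_≡_; refl)
open import Relation.Nullary.Decidable using (Dec; yes; no; _×-dec_; _⊎-dec_)

data Step : Set where
  N E : Step

infix 4 _≟_

_≟_ : DecidableEquality Step
N ≟ N = yes refl
N ≟ E = no λ ()
E ≟ N = no λ ()
E ≟ E = yes refl

Word : Set
Word = List Step

#_ : Step → Word → ℕ
(# s) w = length (filter (s ≟_) w)

-- The lattice points visited by w are ((# E) u , (# N) u) for the prefixes u of
-- w.  A half-plane is convex, so the path stays weakly above y = (a/b)x as soon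
-- as these points do; the inequality (a/b)x ≤ y is multiplied through by b > 0.
record IsDyckPath (a b : ℕ) (w : Word) : Set where
  field
    northSteps : (# N) w ≡ a
    eastSteps  : (# E) w ≡ b
    aboveLine  : All (λ u → a * (# E) u ≤ b * (# N) u) (inits w)

-- In the word u ++ v, an occurrence of NⁱE at the beginning of v is a vertical run.
VerticalRunAt : ℕ → Word × Word → Set
VerticalRunAt i (u , v) =
  (u ≡ [] ⊎ last u ≡ just E) × Prefix _≡_ (replicate i N ∷ʳ E) v

verticalRunAt? : ∀ i s → Dec (VerticalRunAt i s)
verticalRunAt? i (u , v) =
  (≡-dec _≟_ u [] ⊎-dec Maybe.≡-dec _≟_ (last u) (just E))
    ×-dec prefix? _≟_ (replicate i N ∷ʳ E) v

-- zip (inits w) (tails w) lists the factorisations w = u ++ v.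
verticalRuns : ℕ → Word → ℕ
verticalRuns i w = length (filter (verticalRunAt? i) (zip (inits w) (tails w)))

HasCardinality : {A : Set} → (A → Set) → ℕ → Set
HasCardinality {A} P k =
  Σ[ xs ∈ List A ] Unique xs × (∀ x → x ∈ xs ⇔ P x) × length xs ≡ k

DyckPathWithRuns : (a b : ℕ) → (Fin (suc a) → ℕ) → Word → Set
DyckPathWithRuns a b m w =
  IsDyckPath a b w × (∀ i → verticalRuns (toℕ i) w ≡ m i)

sumFin : ∀ {n} → (Fin n → ℕ) → ℕ
sumFin f = sum (tabulate f)

productOfFactorials : ∀ {n} → (Fin n → ℕ) → ℕ
productOfFactorials m = product (tabulate (λ i → m i !))

productOfFactorials≢0 : ∀ {n} (m : Fin n → ℕ) → NonZero (productOfFactorials m)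
productOfFactorials≢0 m = product≢0 (tabulate⁺ (λ i → m i !≢0))

multinomial : ∀ {n} → ℕ → (Fin n → ℕ) → ℚ
multinomial b m = (+ (b !) / productOfFactorials m) {{productOfFactorials≢0 m}}

{-# OPTIONS --safe #-}
-- A word ending in E is determined by the list of its b run lengths, and there
-- are b!/(m₀!⋯mₐ!) lists with the prescribed multiplicities.  Weigh a list ns by
-- b·sum ns − a·length ns: the word is a Dyck path iff all prefixes of its list
-- have nonnegative weight.  Cutting a list of total weight 0 at a prefix of
-- minimal weight and swapping the two parts gives a rotation that is Dyck.  By
-- coprimality a prefix of weight 0 is empty or everything, so no nontrivial
-- rotation of a Dyck list is Dyck.  Hence the b rotations of the Dyck lists
-- enumerate all the lists, each exactly once.
module Submission where

open import Defs
open import Data.Fin.Base using (Fin; toℕ)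
open import Data.Integer.Base using (+_)
open import Data.Nat.Base using (ℕ; suc; _!; NonZero)
open import Data.Nat.Coprimality using (Coprime)
open import Data.Product.Base using (_×_; Σ-syntax)
open import Data.Rational.Base using (_/_; _*_)
open import Relation.Binary.PropositionalEquality using (_≡_)
import Data.Nat.Base as ℕ

open import Algebra.Bundles using (CommutativeMonoid)
import Algebra.Properties.AbelianGroup as AbelianGroupProperties
import Algebra.Properties.CommutativeSemigroup as CommutativeSemigroupProperties
open import Data.Fin.Base using (fromℕ<) renaming (zero to fzero; suc to fsuc)
import Data.Fin.Properties as Fin
open import Data.Integer.Base using (ℤ; 0ℤ)
import Data.Integer.Base as ℤ
import Data.Integer.Properties as ℤ
open import Data.List.Base using (List; []; _∷_; [_]; _∷ʳ_; _++_; cartesianProduct; concat; drop; filter; foldr; inits; last; length; map; replicate; tabulate; tails; take; upTo; zip)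
open import Data.List.Membership.Propositional using (_∈_)
open import Data.List.Membership.Propositional.Properties using (∈-cartesianProduct⁺; ∈-cartesianProduct⁻; ∈-concat⁺′; ∈-concat⁻′; ∈-filter⁺; ∈-filter⁻; ∈-map⁺; ∈-map⁻; ∈-tabulate⁺; ∈-tabulate⁻; ∈-upTo⁺; ∈-upTo⁻)
open import Data.List.Membership.Propositional.Properties.WithK using (unique∧set⇒bag)
open import Data.List.Properties using (++-assoc; ++-conicalʳ; ++-identityʳ; ∷-injective; ∷-injectiveˡ; ∷-injectiveʳ; filter-++; filter-accept; filter-reject; length-++; length-map; length-take; length-upTo; map-cong; map-id; map-∘; take++drop≡id)
open import Data.List.Relation.Binary.BagAndSetEquality using (∼bag⇒↭)
open import Data.List.Relation.Binary.Permutation.Propositional.Properties using (↭-length)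
open import Data.List.Relation.Binary.Prefix.Heterogeneous using (Prefix; []; _∷_)
open import Data.List.Relation.Unary.All using (All; []; _∷_; all?)
import Data.List.Relation.Unary.All as All
import Data.List.Relation.Unary.All.Properties as All
open import Data.List.Relation.Unary.Any using (here; there)
import Data.List.Relation.Unary.AllPairs.Properties as AllPairs
open import Data.List.Relation.Unary.AllPairs using ([]; _∷_)
open import Data.List.Relation.Unary.Unique.Propositional using (Unique)
import Data.List.Relation.Unary.Unique.Propositional.Properties as Unique
open import Data.Maybe.Base using (just)
open import Data.Nat.Base using (zero; _+_; _≤_; _<_; _∸_; pred; z≤n; s≤s)
open import Data.Nat.Coprimality using (coprime-divisor)
import Data.Nat.Coprimality as Coprimality
open import Data.Nat.Divisibility using (_∣_; divides; ∣⇒≤)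
open import Data.Nat.ListAction using (sum)
open import Data.Nat.ListAction.Properties using (sum-++)
import Data.Nat.Properties as ℕ
open import Data.Product.Base using (∃; ∃₂; _,_; proj₁; proj₂)
import Data.Product.Base as Product
import Data.Rational.Base as ℚ
open import Data.Rational.Base using (ℚ)
import Data.Rational.Properties as ℚ
import Data.Rational.Unnormalised.Base as ℚᵘ
import Data.Rational.Unnormalised.Properties as ℚᵘ
open import Data.Sum.Base using (_⊎_; inj₁; inj₂)
import Data.Sum.Base as Sum
open import Data.Vec.Functional using (updateAt)
open import Data.Vec.Functional.Properties using (updateAt-updates; updateAt-minimal)
open import Function.Base using (_∘_; const; id)
open import Function.Bundles using (_⇔_; mk⇔; Equivalence)
open import Level using (0ℓ)
open import Relation.Binary.PropositionalEquality using (_≢_; refl; sym; trans; cong; cong₂; subst; subst₂; module ≡-Reasoning)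
open import Relation.Nullary.Decidable using (yes; no)
open import Relation.Nullary.Negation using (¬_; contradiction)

-- Lists

-- Of two cuts of one list, one comes no later than the other; `r` is the piece between them. If the
-- cuts coincide, the first alternative is returned with `r` empty.
++-split : ∀ {A : Set} (v : List A) {u} p {q} → v ++ u ≡ p ++ q →
  (∃ λ r → v ≡ p ++ r × q ≡ r ++ u) ⊎ (∃ λ r → p ≡ v ++ r × u ≡ r ++ q)
++-split v       []      eq = inj₁ (v , refl , sym eq)
++-split []      (x ∷ p) eq = inj₂ (x ∷ p , refl , eq)
++-split (y ∷ v) (x ∷ p) eq with ∷-injective eq
... | refl , eq′ = Sum.map (Product.map₂ (Product.map₁ (cong (x ∷_))))
                           (Product.map₂ (Product.map₁ (cong (x ∷_)))) (++-split v p eq′)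

length≡0⇒≡[] : ∀ {A : Set} {xs : List A} → length xs ≡ 0 → xs ≡ []
length≡0⇒≡[] {xs = []} _ = refl

length-cartesianProduct : ∀ {A B : Set} (xs : List A) (ys : List B) →
  length (cartesianProduct xs ys) ≡ length xs ℕ.* length ys
length-cartesianProduct []       ys = refl
length-cartesianProduct (x ∷ xs) ys = begin
  length (map (x ,_) ys ++ cartesianProduct xs ys)           ≡⟨ length-++ (map (x ,_) ys) ⟩
  length (map (x ,_) ys) + length (cartesianProduct xs ys)   ≡⟨ cong₂ _+_ (length-map (x ,_) ys) (length-cartesianProduct xs ys) ⟩
  length ys + length xs ℕ.* length ys                        ∎
  where open ≡-Reasoning

-- Injectivity is asked on the members of `xs` only, since rotation is injective just on suitably
-- restricted pairs of a shift and a list.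
Unique-map⁺-∈ : ∀ {A B : Set} (f : A → B) {xs} →
  (∀ {x y} → x ∈ xs → y ∈ xs → f x ≡ f y → x ≡ y) → Unique xs → Unique (map f xs)
Unique-map⁺-∈ f inj []         = []
Unique-map⁺-∈ f inj (x∉xs ∷ u) =
  All.map⁺ (All.tabulate λ y∈xs eq → All.lookup x∉xs y∈xs (inj (here refl) (there y∈xs) eq))
  ∷ Unique-map⁺-∈ f (λ x∈ y∈ → inj (there x∈) (there y∈)) u

-- Without repetitions, equality as sets is equality as bags, so the two lists are permutations of
-- each other.
Unique∧set⇒length : ∀ {A : Set} {xs ys : List A} → Unique xs → Unique ys →
  (∀ x → x ∈ xs ⇔ x ∈ ys) → length xs ≡ length ys
Unique∧set⇒length xs! ys! eq = ↭-length (∼bag⇒↭ (unique∧set⇒bag xs! ys! (λ {x} → eq x)))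

∈-inits⁺ : ∀ {A : Set} (u : List A) {v} → u ∈ inits (u ++ v)
∈-inits⁺ []      = here refl
∈-inits⁺ (x ∷ u) = there (∈-map⁺ (x ∷_) (∈-inits⁺ u))

∈-inits⁻ : ∀ {A : Set} (xs : List A) {u} → u ∈ inits xs → ∃ λ v → xs ≡ u ++ v
∈-inits⁻ xs       (here refl) = xs , refl
∈-inits⁻ (x ∷ xs) (there u∈)  with ∈-map⁻ (x ∷_) u∈
... | u , u∈′ , refl = Product.map₂ (cong (x ∷_)) (∈-inits⁻ xs u∈′)

last-∷ʳ : ∀ {A : Set} (xs : List A) x → last (xs ∷ʳ x) ≡ just x
last-∷ʳ []           x = refl
last-∷ʳ (_ ∷ [])     x = refl
last-∷ʳ (_ ∷ y ∷ xs) x = last-∷ʳ (y ∷ xs) x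

-- The cycle lemma

-- The function `h` is arbitrary so that the induction can pass to `h ∘ (x ∷_)`, whose values on
-- prefixes of the tail are those of `h` on the nonempty prefixes. Their minimum is then compared
-- with `h []`.
minimalPrefix : ∀ {A : Set} (h : List A → ℤ) xs →
  ∃₂ λ u v → xs ≡ u ++ v × (∀ u′ v′ → xs ≡ u′ ++ v′ → h u ℤ.≤ h u′)
minimalPrefix h []       = [] , [] , refl , λ { [] _ _ → ℤ.≤-refl }
minimalPrefix h (x ∷ xs) with minimalPrefix (h ∘ (x ∷_)) xs
... | u , v , xs≡ , min with ℤ.≤-total (h []) (h (x ∷ u))
...   | inj₁ h[]≤ = [] , x ∷ xs , refl , λ
  { []       v′ _  → ℤ.≤-refl
  ; (y ∷ u′) v′ eq → ℤ.≤-trans h[]≤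
      (subst (λ z → h (x ∷ u) ℤ.≤ h (z ∷ u′)) (∷-injectiveˡ eq) (min u′ v′ (∷-injectiveʳ eq))) }
...   | inj₂ ≤h[] = x ∷ u , v , cong (x ∷_) xs≡ , λ
  { []       v′ _  → ≤h[]
  ; (y ∷ u′) v′ eq →
      subst (λ z → h (x ∷ u) ℤ.≤ h (z ∷ u′)) (∷-injectiveˡ eq) (min u′ v′ (∷-injectiveʳ eq)) }

NonNegative : ∀ {A : Set} → (List A → ℤ) → List A → Set
NonNegative φ xs = ∀ u v → xs ≡ u ++ v → 0ℤ ℤ.≤ φ u

rotate : ∀ {A : Set} → ℕ → List A → List A
rotate k xs = drop k xs ++ take k xs

module CycleLemma {A : Set} (φ : List A → ℤ) (φ-++ : ∀ u v → φ (u ++ v) ≡ φ u ℤ.+ φ v) where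

  nonNegativeRotation : ∀ xs → φ xs ≡ 0ℤ → ∃₂ λ u v → xs ≡ u ++ v × NonNegative φ (v ++ u)
  nonNegativeRotation xs φxs≡0 with minimalPrefix φ xs
  ... | u , v , refl , min = u , v , refl , nonNeg
    where
    nonNeg : NonNegative φ (v ++ u)
    nonNeg p q eq with ++-split v p eq
    -- The prefix `p` ends inside `v`: its weight is the weight of `u ++ p` minus the minimal
    -- weight, that of `u`.
    ... | inj₁ (r , refl , _) = begin
      0ℤ                     ≤⟨ ℤ.i≤j⇒0≤j-i (min (u ++ p) r (sym (++-assoc u p r))) ⟩
      φ (u ++ p) ℤ.- φ u     ≡⟨ cong (ℤ._- φ u) (φ-++ u p) ⟩
      φ u ℤ.+ φ p ℤ.- φ u    ≡⟨ xyx⁻¹≈y (φ u) (φ p) ⟩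
      φ p                    ∎
      where
      open ℤ.≤-Reasoning
      open AbelianGroupProperties ℤ.+-0-abelianGroup using (xyx⁻¹≈y)
    -- The prefix is `v ++ r` with `r` a prefix of `u`: replacing `r` by the minimal `u` gives the
    -- total weight 0 as a lower bound.
    ... | inj₂ (r , refl , refl) = begin
      0ℤ                 ≡⟨ φxs≡0 ⟨
      φ (u ++ v)         ≡⟨ φ-++ u v ⟩
      φ u ℤ.+ φ v        ≤⟨ ℤ.+-monoˡ-≤ (φ v) (min r (q ++ v) (++-assoc r q v)) ⟩
      φ r ℤ.+ φ v        ≡⟨ ℤ.+-comm (φ r) (φ v) ⟩
      φ v ℤ.+ φ r        ≡⟨ φ-++ v r ⟨
      φ (v ++ r)         ∎
      where open ℤ.≤-Reasoning

  -- Each of `u` and `v` is a prefix of one of the two rotations, so both weights are nonnegative,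
  -- and they add up to 0.
  rotationsNonNegative⇒φ≡0 : ∀ u v → φ (u ++ v) ≡ 0ℤ →
    NonNegative φ (u ++ v) → NonNegative φ (v ++ u) → φ u ≡ 0ℤ
  rotationsNonNegative⇒φ≡0 u v φuv≡0 nu nv = ℤ.≤-antisym (begin
    φ u          ≡⟨ ℤ.+-identityʳ (φ u) ⟨
    φ u ℤ.+ 0ℤ   ≤⟨ ℤ.+-monoʳ-≤ (φ u) (nv v u refl) ⟩
    φ u ℤ.+ φ v  ≡⟨ φ-++ u v ⟨
    φ (u ++ v)   ≡⟨ φuv≡0 ⟩
    0ℤ           ∎) (nu u v refl)
    where open ℤ.≤-Reasoning

  -- In the application `P` is `Content m`, the arrangements of a fixed multiset; coprimality enters
  -- through `φ≡0⇒trivial`.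
  module _ {P : List A → Set} {n : ℕ}
    (P⇒length : ∀ {xs} → P xs → length xs ≡ n)
    (P⇒φ≡0 : ∀ {xs} → P xs → φ xs ≡ 0ℤ)
    (P-rotate : ∀ u v → P (u ++ v) → P (v ++ u))
    (φ≡0⇒trivial : ∀ u v → P (u ++ v) → φ u ≡ 0ℤ → u ≡ [] ⊎ v ≡ [])
    where

    -- The two nonnegative lists differ by moving `r` from the front to the back, so `r` has weight
    -- 0 and is either empty or the whole list. The length bound excludes the latter.
    overlap≡[] : ∀ r u v → P ((r ++ u) ++ v) → length (r ++ u) < n →
      NonNegative φ ((r ++ u) ++ v) → NonNegative φ (u ++ v ++ r) → r ≡ []
    overlap≡[] r u v Pruv ru<n n₁ n₂
      with Pruv′ ← subst P (++-assoc r u v) Pruv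
      with φ≡0⇒trivial r (u ++ v) Pruv′
        (rotationsNonNegative⇒φ≡0 r (u ++ v) (P⇒φ≡0 Pruv′)
          (subst (NonNegative φ) (++-assoc r u v) n₁)
          (subst (NonNegative φ) (sym (++-assoc u v r)) n₂))
    ... | inj₁ r≡[] = r≡[]
    -- Here `r ++ u` is the whole list, whose length is `n`, against `ru<n`.
    overlap≡[] r [] [] Pruv ru<n n₁ n₂ | inj₂ refl =
      contradiction (trans (cong length (sym (++-identityʳ (r ++ [])))) (P⇒length Pruv)) (ℕ.<⇒≢ ru<n)

    -- Align the two cuts of the common rotation: the piece `r` between them is empty by
    -- `overlap≡[]`. The strict length bounds keep a full turn from being confused with no turn.
    nonNegativeRotation-unique : ∀ u v u′ v′ → P (u ++ v) → P (u′ ++ v′) →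
      NonNegative φ (u ++ v) → NonNegative φ (u′ ++ v′) →
      length u < n → length u′ < n → v ++ u ≡ v′ ++ u′ → u ≡ u′ × v ≡ v′
    nonNegativeRotation-unique u v u′ v′ Puv Pu′v′ nuv nu′v′ u<n u′<n eq with ++-split v v′ eq
    ... | inj₁ (r , refl , refl) with refl ← overlap≡[] r u v′ Pu′v′ u′<n nu′v′ nuv =
      refl , ++-identityʳ v′
    ... | inj₂ (r , refl , refl) with refl ← overlap≡[] r u′ v Puv u<n nuv nu′v′ =
      refl , sym (++-identityʳ v)

    -- Rotation is a bijection from pairs of a shift below `n` and a nonnegative list onto `xs`:
    -- injective by uniqueness of the nonnegative rotation, surjective by its existence.
    length≡n*nonNegatives : ∀ {xs ds} → Unique xs → (∀ x → x ∈ xs ⇔ P x) →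
      Unique ds → (∀ d → d ∈ ds ⇔ (P d × NonNegative φ d)) → 0 < n →
      length xs ≡ n ℕ.* length ds
    length≡n*nonNegatives {xs} {ds} xs! ∈xs ds! ∈ds 0<n = begin
      length xs                        ≡⟨ Unique∧set⇒length xs! rotations! (λ x → mk⇔ (to x) (from x)) ⟩
      length (map rot pairs)           ≡⟨ length-map rot pairs ⟩
      length pairs                     ≡⟨ length-cartesianProduct (upTo n) ds ⟩
      length (upTo n) ℕ.* length ds    ≡⟨ cong (ℕ._* length ds) (length-upTo n) ⟩
      n ℕ.* length ds                  ∎
      where
      open ≡-Reasoning
      open Equivalence using () renaming (to to ⟶; from to ⟵)

      pairs : List (ℕ × List A)
      pairs = cartesianProduct (upTo n) ds

      rot : ℕ × List A → List A
      rot (k , d) = rotate k d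

      length-take-< : ∀ {k d} → P d → k ∈ upTo n → length (take k d) ≡ k
      length-take-< {k} {d} Pd k∈ = trans (length-take k d)
        (ℕ.m≤n⇒m⊓n≡m (subst (k ≤_) (sym (P⇒length Pd)) (ℕ.<⇒≤ (∈-upTo⁻ k∈))))

      rot-injective : ∀ {kd ld′} → kd ∈ pairs → ld′ ∈ pairs → rot kd ≡ rot ld′ → kd ≡ ld′
      rot-injective {k , d} {l , d′} kd∈ ld′∈ eq
        with k∈ , d∈ ← ∈-cartesianProduct⁻ (upTo n) ds kd∈
           | l∈ , d′∈ ← ∈-cartesianProduct⁻ (upTo n) ds ld′∈
        with Pd , nd ← ⟶ (∈ds d) d∈ | Pd′ , nd′ ← ⟶ (∈ds d′) d′∈
        with t≡ , r≡ ← nonNegativeRotation-unique (take k d) (drop k d) (take l d′) (drop l d′)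
               (subst P (sym (take++drop≡id k d)) Pd)
               (subst P (sym (take++drop≡id l d′)) Pd′)
               (subst (NonNegative φ) (sym (take++drop≡id k d)) nd)
               (subst (NonNegative φ) (sym (take++drop≡id l d′)) nd′)
               (subst (_< n) (sym (length-take-< Pd k∈)) (∈-upTo⁻ k∈))
               (subst (_< n) (sym (length-take-< Pd′ l∈)) (∈-upTo⁻ l∈)) eq
        -- The shift is recovered as the length of the part taken off, the list by rejoining its two
        -- parts.
        = cong₂ _,_
            (trans (sym (length-take-< Pd k∈)) (trans (cong length t≡) (length-take-< Pd′ l∈)))
            (trans (sym (take++drop≡id k d)) (trans (cong₂ _++_ t≡ r≡) (take++drop≡id l d′)))

      rotations! : Unique (map rot pairs)
      rotations! = Unique-map⁺-∈ rot rot-injective (Unique.cartesianProduct⁺ (Unique.upTo⁺ n) ds!)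

      rotate∈ : ∀ u v k → k < n → rotate k (v ++ u) ≡ u ++ v → P (u ++ v) →
        NonNegative φ (v ++ u) → u ++ v ∈ map rot pairs
      rotate∈ u v k k<n eq Puv nvu = subst (_∈ map rot pairs) eq
        (∈-map⁺ rot (∈-cartesianProduct⁺ (∈-upTo⁺ k<n) (⟵ (∈ds (v ++ u)) (P-rotate u v Puv , nvu))))

      rotate-length : ∀ (v u : List A) → rotate (length v) (v ++ u) ≡ u ++ v
      rotate-length v u = cong₂ _++_ (drop-length v) (take-length v)
        where
        drop-length : ∀ (v : List A) → drop (length v) (v ++ u) ≡ u
        drop-length []      = refl
        drop-length (_ ∷ v) = drop-length v
        take-length : ∀ (v : List A) → take (length v) (v ++ u) ≡ v
        take-length []      = refl
        take-length (x ∷ v) = cong (x ∷_) (take-length v)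

      to : ∀ x → x ∈ xs → x ∈ map rot pairs
      to x x∈ with Px ← ⟶ (∈xs x) x∈ with nonNegativeRotation x (P⇒φ≡0 Px)
      -- With `u` empty, the shift `length v` would be `n` and out of range, so the shift 0 is used
      -- instead.
      ... | [] , v , refl , nv =
        rotate∈ [] v 0 0<n (trans (++-identityʳ (v ++ [])) (++-identityʳ v)) Px nv
      ... | u@(_ ∷ u′) , v , refl , nvu = rotate∈ u v (length v)
        (subst (length v <_) (trans (sym (length-++ u)) (P⇒length Px)) (s≤s (ℕ.m≤n+m (length v) (length u′))))
        (rotate-length v u) Px nvu

      from : ∀ x → x ∈ map rot pairs → x ∈ xs
      from x x∈ with ∈-map⁻ rot x∈
      ... | (k , d) , kd∈ , refl with _ , d∈ ← ∈-cartesianProduct⁻ (upTo n) ds kd∈ =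
        ⟵ (∈xs (rotate k d)) (P-rotate (take k d) (drop k d)
          (subst P (sym (take++drop≡id k d)) (proj₁ (⟶ (∈ds d) d∈))))

-- Finite sums and products

module _ (M : CommutativeMonoid 0ℓ 0ℓ) where

  open CommutativeMonoid M renaming (refl to ≈-refl; trans to ≈-trans; sym to ≈-sym)
  open CommutativeSemigroupProperties commutativeSemigroup using (x∙yz≈y∙xz)

  -- Stated for a commutative monoid so that it serves both sums and products of factorials when a
  -- single multiplicity changes.
  foldr-tabulate-scale : ∀ {n} (f g : Fin n → Carrier) i c →
    f i ≈ c ∙ g i → (∀ j → j ≢ i → f j ≈ g j) →
    foldr _∙_ ε (tabulate f) ≈ c ∙ foldr _∙_ ε (tabulate g)
  foldr-tabulate-scale f g fzero c fi≈ fj≈ =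
    ≈-trans (∙-cong fi≈ (foldr-tabulate-cong (λ j → fj≈ (fsuc j) λ ()))) (assoc c _ _)
    where
    foldr-tabulate-cong : ∀ {n} {f g : Fin n → Carrier} → (∀ j → f j ≈ g j) →
      foldr _∙_ ε (tabulate f) ≈ foldr _∙_ ε (tabulate g)
    foldr-tabulate-cong {zero}  eq = ≈-refl
    foldr-tabulate-cong {suc n} eq = ∙-cong (eq fzero) (foldr-tabulate-cong (eq ∘ fsuc))
  foldr-tabulate-scale f g (fsuc i) c fi≈ fj≈ =
    ≈-trans (∙-cong (fj≈ fzero λ ())
                    (foldr-tabulate-scale (f ∘ fsuc) (g ∘ fsuc) i c fi≈
                      (λ j j≢i → fj≈ (fsuc j) (j≢i ∘ Fin.suc-injective))))
            (x∙yz≈y∙xz _ c _)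

sumFin-cong : ∀ {n} {f g : Fin n → ℕ} → (∀ i → f i ≡ g i) → sumFin f ≡ sumFin g
sumFin-cong {zero}  eq = refl
sumFin-cong {suc n} eq = cong₂ _+_ (eq fzero) (sumFin-cong (eq ∘ fsuc))

sumFin-*ʳ : ∀ {n} (f : Fin n → ℕ) c → sumFin f ℕ.* c ≡ sumFin (λ i → f i ℕ.* c)
sumFin-*ʳ {zero}  f c = refl
sumFin-*ʳ {suc n} f c =
  trans (ℕ.*-distribʳ-+ c (f fzero) _) (cong (_+_ (f fzero ℕ.* c)) (sumFin-*ʳ (f ∘ fsuc) c))

sumFin-zero : ∀ {n} {f : Fin n → ℕ} → (∀ i → f i ≡ 0) → sumFin f ≡ 0
sumFin-zero {zero}  f≡0 = refl
sumFin-zero {suc n} f≡0 = cong₂ _+_ (f≡0 fzero) (sumFin-zero (f≡0 ∘ fsuc))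

sumFin≡0⇒≡0 : ∀ {n} (f : Fin n → ℕ) → sumFin f ≡ 0 → ∀ i → f i ≡ 0
sumFin≡0⇒≡0 f eq fzero    = ℕ.m+n≡0⇒m≡0 (f fzero) eq
sumFin≡0⇒≡0 f eq (fsuc i) = sumFin≡0⇒≡0 (f ∘ fsuc) (ℕ.m+n≡0⇒n≡0 (f fzero) eq) i

productOfFactorials-zero : ∀ {n} (m : Fin n → ℕ) → (∀ i → m i ≡ 0) → productOfFactorials m ≡ 1
productOfFactorials-zero {zero}  m m≡0 = refl
productOfFactorials-zero {suc n} m m≡0 =
  cong₂ ℕ._*_ (cong _! (m≡0 fzero)) (productOfFactorials-zero (m ∘ fsuc) (m≡0 ∘ fsuc))

length-concat-tabulate : ∀ {A : Set} {n} (f : Fin n → List A) →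
  length (concat (tabulate f)) ≡ sumFin (length ∘ f)
length-concat-tabulate {n = zero}  f = refl
length-concat-tabulate {n = suc n} f =
  trans (length-++ (f fzero)) (cong (_+_ (length (f fzero))) (length-concat-tabulate (f ∘ fsuc)))

decrement : ∀ {k} → (Fin k → ℕ) → Fin k → (Fin k → ℕ)
decrement m i = updateAt m i pred

module _ {k} (m : Fin k → ℕ) (i : Fin k) {c : ℕ} (mi≡ : m i ≡ suc c) where

  decrement-at : m i ≡ suc (decrement m i i)
  decrement-at = trans mi≡ (cong suc (sym (trans (updateAt-updates i m) (cong pred mi≡))))

  sumFin-decrement : sumFin m ≡ suc (sumFin (decrement m i))
  sumFin-decrement = foldr-tabulate-scale ℕ.+-0-commutativeMonoid m (decrement m i) i 1
    decrement-at (λ j j≢i → sym (updateAt-minimal j i m j≢i))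

  -- Only the factor at `i` changes, from the factorial of `suc c` to that of `c`.
  productOfFactorials-decrement : productOfFactorials m ≡ suc c ℕ.* productOfFactorials (decrement m i)
  productOfFactorials-decrement =
    foldr-tabulate-scale ℕ.*-1-commutativeMonoid (λ j → m j !) (λ j → decrement m i j !) i (suc c)
      (subst₂ (λ x y → x ! ≡ suc c ℕ.* (y !)) (sym mi≡)
        (sym (trans (updateAt-updates i m) (cong pred mi≡))) refl)
      (λ j j≢i → cong _! (sym (updateAt-minimal j i m j≢i)))

-- Arrangements of a multiset

occurrences : ℕ → List ℕ → ℕ
occurrences x ns = length (filter (x ℕ.≟_) ns)

occurrences-here : ∀ x ns → occurrences x (x ∷ ns) ≡ suc (occurrences x ns)
occurrences-here x ns = cong length (filter-accept (x ℕ.≟_) refl)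

occurrences-there : ∀ {x y} ns → x ≢ y → occurrences x (y ∷ ns) ≡ occurrences x ns
occurrences-there {x} ns x≢y = cong length (filter-reject (x ℕ.≟_) x≢y)

occurrences-++ : ∀ x u v → occurrences x (u ++ v) ≡ occurrences x u + occurrences x v
occurrences-++ x u v = trans (cong length (filter-++ (x ℕ.≟_) u v)) (length-++ (filter (x ℕ.≟_) u))

-- Double counting: an entry `x` contributes `h x` to either side. Taking `h` to be `id` yields the
-- sum of the list, and `const 1` its length.
sumFin-occurrences : ∀ {k} (h : ℕ → ℕ) {ns} → All (_< k) ns →
  sumFin {k} (λ i → h (toℕ i) ℕ.* occurrences (toℕ i) ns) ≡ sum (map h ns)
sumFin-occurrences {k} h [] = sumFin-zero {k} (λ i → ℕ.*-zeroʳ (h (toℕ i)))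
sumFin-occurrences {k} h {x ∷ ns} (x<k ∷ ns<k) with fromℕ< x<k | Fin.toℕ-fromℕ< x<k
... | i | refl = trans
  (foldr-tabulate-scale ℕ.+-0-commutativeMonoid
    (λ j → h (toℕ j) ℕ.* occurrences (toℕ j) (toℕ i ∷ ns))
    (λ j → h (toℕ j) ℕ.* occurrences (toℕ j) ns) i (h (toℕ i))
    (trans (cong (h (toℕ i) ℕ.*_) (occurrences-here (toℕ i) ns)) (ℕ.*-suc (h (toℕ i)) _))
    (λ j j≢i → cong (h (toℕ j) ℕ.*_) (occurrences-there ns (j≢i ∘ Fin.toℕ-injective))))
  (cong (_+_ (h (toℕ i))) (sumFin-occurrences h ns<k))

-- The bound is part of the definition because the counts over `Fin k` do not see entries from `k`
-- on.
Content : ∀ {k} → (Fin k → ℕ) → List ℕ → Set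
Content {k} m ns = All (_< k) ns × (∀ i → occurrences (toℕ i) ns ≡ m i)

module _ {k} {m : Fin k → ℕ} where

  Content-sum-map : ∀ h {ns} → Content m ns → sum (map h ns) ≡ sumFin (λ i → h (toℕ i) ℕ.* m i)
  Content-sum-map h (ns<k , occ) =
    trans (sym (sumFin-occurrences h ns<k)) (sumFin-cong (λ i → cong (h (toℕ i) ℕ.*_) (occ i)))

  Content-sum : ∀ {ns} → Content m ns → sum ns ≡ sumFin (λ i → toℕ i ℕ.* m i)
  Content-sum {ns} c = trans (cong sum (sym (map-id ns))) (Content-sum-map id c)

  Content-length : ∀ {ns} → Content m ns → length ns ≡ sumFin m
  Content-length {ns} c = trans (sym (sum-ones ns))
    (trans (Content-sum-map (const 1) c) (sumFin-cong (λ i → ℕ.*-identityˡ (m i))))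
    where
    sum-ones : ∀ (ns : List ℕ) → sum (map (const 1) ns) ≡ length ns
    sum-ones []       = refl
    sum-ones (_ ∷ ns) = cong suc (sum-ones ns)

  Content-rotate : ∀ u v → Content m (u ++ v) → Content m (v ++ u)
  Content-rotate u v (uv<k , occ) = All.++⁺ (All.++⁻ʳ u uv<k) (All.++⁻ˡ u uv<k) , λ i → begin
    occurrences (toℕ i) (v ++ u)                        ≡⟨ occurrences-++ (toℕ i) v u ⟩
    occurrences (toℕ i) v + occurrences (toℕ i) u       ≡⟨ ℕ.+-comm (occurrences (toℕ i) v) _ ⟩
    occurrences (toℕ i) u + occurrences (toℕ i) v       ≡⟨ occurrences-++ (toℕ i) u v ⟨
    occurrences (toℕ i) (u ++ v)                        ≡⟨ occ i ⟩
    m i                                                 ∎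
    where open ≡-Reasoning

  Content-∷⁺ : ∀ i {c ns} → m i ≡ suc c → Content (decrement m i) ns → Content m (toℕ i ∷ ns)
  Content-∷⁺ i {ns = ns} mi≡ (ns<k , occ) = Fin.toℕ<n i ∷ ns<k , occ′
    where
    occ′ : ∀ j → occurrences (toℕ j) (toℕ i ∷ ns) ≡ m j
    occ′ j with j Fin.≟ i
    ... | yes refl = trans (occurrences-here (toℕ i) ns)
                           (trans (cong suc (occ i)) (sym (decrement-at m i mi≡)))
    ... | no  j≢i  = trans (occurrences-there ns (j≢i ∘ Fin.toℕ-injective))
                           (trans (occ j) (updateAt-minimal j i m j≢i))

  Content-∷⁻ : ∀ i {ns} → Content m (toℕ i ∷ ns) →
    m i ≡ suc (occurrences (toℕ i) ns) × Content (decrement m i) ns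
  Content-∷⁻ i {ns} (_ ∷ ns<k , occ) = mi≡ , ns<k , occ′
    where
    mi≡ : m i ≡ suc (occurrences (toℕ i) ns)
    mi≡ = trans (sym (occ i)) (occurrences-here (toℕ i) ns)

    occ′ : ∀ j → occurrences (toℕ j) ns ≡ decrement m i j
    occ′ j with j Fin.≟ i
    ... | yes refl = ℕ.suc-injective (trans (sym mi≡) (decrement-at m i mi≡))
    ... | no  j≢i  = trans (sym (occurrences-there ns (j≢i ∘ Fin.toℕ-injective)))
                           (trans (occ j) (sym (updateAt-minimal j i m j≢i)))

-- Choose the first entry, then arrange what is left. The number is meant to be the size `sumFin m`
-- of the multiset and carries the recursion.
arrangements : ∀ {k} → ℕ → (Fin k → ℕ) → List (List ℕ)
arrangementsFrom : ∀ {k} → ℕ → (Fin k → ℕ) → Fin k → ℕ → List (List ℕ)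

arrangements zero    m = [] ∷ []
arrangements (suc n) m = concat (tabulate λ i → arrangementsFrom n m i (m i))

-- The last argument is m i; if it is 0, no arrangement starts with i.
arrangementsFrom n m i zero    = []
arrangementsFrom n m i (suc _) = map (toℕ i ∷_) (arrangements n (decrement m i))

∈-arrangementsFrom⁻ : ∀ {k} n (m : Fin k → ℕ) i c {ns} → ns ∈ arrangementsFrom n m i c →
  ∃ λ ns′ → ns ≡ toℕ i ∷ ns′
∈-arrangementsFrom⁻ n m i (suc c) ns∈ with ∈-map⁻ (toℕ i ∷_) ns∈
... | ns′ , _ , ns≡ = ns′ , ns≡

∈-arrangements⁻ : ∀ {k} n (m : Fin k → ℕ) → sumFin m ≡ n → ∀ {ns} →
  ns ∈ arrangements n m → Content m ns
∈-arrangements⁻ zero    m Σm≡ (here refl) = [] , λ i → sym (sumFin≡0⇒≡0 m Σm≡ i)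
∈-arrangements⁻ (suc n) m Σm≡ ns∈
  with _ , ns∈′ , ∈tab ← ∈-concat⁻′ (tabulate λ i → arrangementsFrom n m i (m i)) ns∈
  with i , refl ← ∈-tabulate⁻ ∈tab = go (m i) refl ns∈′
  where
  -- Generalising `m i` to `c` allows a case split on it; for `c` zero there is no member to
  -- consider.
  go : ∀ c → m i ≡ c → ∀ {ns} → ns ∈ arrangementsFrom n m i c → Content m ns
  go (suc c) mi≡ ns∈ with ∈-map⁻ (toℕ i ∷_) ns∈
  ... | ns′ , ns′∈ , refl = Content-∷⁺ i mi≡ (∈-arrangements⁻ n (decrement m i)
    (ℕ.suc-injective (trans (sym (sumFin-decrement m i mi≡)) Σm≡)) ns′∈)

∈-arrangements⁺ : ∀ {k} n (m : Fin k → ℕ) → sumFin m ≡ n → ∀ {ns} →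
  Content m ns → ns ∈ arrangements n m
∈-arrangements⁺ zero    m Σm≡ {ns} c with refl ← length≡0⇒≡[] {xs = ns} (trans (Content-length c) Σm≡) = here refl
∈-arrangements⁺ (suc n) m Σm≡ {[]} c = contradiction (trans (Content-length c) Σm≡) λ ()
∈-arrangements⁺ (suc n) m Σm≡ {x ∷ ns} c@(x<k ∷ _ , _) with fromℕ< x<k | Fin.toℕ-fromℕ< x<k
... | i | refl with mi≡ , c′ ← Content-∷⁻ i c =
  ∈-concat⁺′
    (subst (λ c → toℕ i ∷ ns ∈ arrangementsFrom n m i c) (sym mi≡)
      (∈-map⁺ (toℕ i ∷_) (∈-arrangements⁺ n (decrement m i)
        (ℕ.suc-injective (trans (sym (sumFin-decrement m i mi≡)) Σm≡)) c′)))
    (∈-tabulate⁺ i)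

-- Blocks for different `i` are disjoint because their members have different first entries.
arrangements! : ∀ {k} n (m : Fin k → ℕ) → Unique (arrangements n m)
arrangementsFrom! : ∀ {k} n (m : Fin k → ℕ) i c → Unique (arrangementsFrom n m i c)

arrangements! zero    m = [] ∷ []
arrangements! (suc n) m = Unique.concat⁺ (All.tabulate⁺ λ i → arrangementsFrom! n m i (m i))
  (AllPairs.tabulate⁺ λ {i} {j} i≢j (∈i , ∈j) → i≢j (Fin.toℕ-injective (∷-injectiveˡ
    (trans (sym (proj₂ (∈-arrangementsFrom⁻ n m i (m i) ∈i)))
           (proj₂ (∈-arrangementsFrom⁻ n m j (m j) ∈j))))))

arrangementsFrom! n m i zero    = []
arrangementsFrom! n m i (suc _) = Unique.map⁺ ∷-injectiveʳ (arrangements! n (decrement m i))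

-- The multinomial count in a form free of division. After multiplication by `P`, the block starting
-- with `i` contributes `m i` times `n !`, and the `m i` add up to `suc n`.
length-arrangements : ∀ {k} n (m : Fin k → ℕ) → sumFin m ≡ n →
  length (arrangements n m) ℕ.* productOfFactorials m ≡ n !
length-arrangements zero    m Σm≡ =
  trans (ℕ.+-identityʳ _) (productOfFactorials-zero m (sumFin≡0⇒≡0 m Σm≡))
length-arrangements (suc n) m Σm≡ = begin
  length (arrangements (suc n) m) ℕ.* P
    ≡⟨ cong (ℕ._* P) (length-concat-tabulate (λ i → arrangementsFrom n m i (m i))) ⟩
  sumFin (λ i → length (arrangementsFrom n m i (m i))) ℕ.* P
    ≡⟨ sumFin-*ʳ (λ i → length (arrangementsFrom n m i (m i))) P ⟩
  sumFin (λ i → length (arrangementsFrom n m i (m i)) ℕ.* P)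
    ≡⟨ sumFin-cong (λ i → startingWith i (m i) refl) ⟩
  sumFin (λ i → m i ℕ.* n !)
    ≡⟨ sumFin-*ʳ m (n !) ⟨
  sumFin m ℕ.* n !
    ≡⟨ cong (ℕ._* n !) Σm≡ ⟩
  suc n !
    ∎
  where
  open ≡-Reasoning

  P : ℕ
  P = productOfFactorials m

  startingWith : ∀ i c → m i ≡ c → length (arrangementsFrom n m i c) ℕ.* P ≡ c ℕ.* n !
  startingWith i zero    mi≡ = refl
  startingWith i (suc c) mi≡ = begin
    length (map (toℕ i ∷_) as) ℕ.* P
      ≡⟨ cong₂ ℕ._*_ (length-map (toℕ i ∷_) as) (productOfFactorials-decrement m i mi≡) ⟩
    length as ℕ.* (suc c ℕ.* P′)
      ≡⟨ x∙yz≈y∙xz (length as) (suc c) P′ ⟩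
    suc c ℕ.* (length as ℕ.* P′)
      ≡⟨ cong (suc c ℕ.*_) (length-arrangements n (decrement m i)
           (ℕ.suc-injective (trans (sym (sumFin-decrement m i mi≡)) Σm≡))) ⟩
    suc c ℕ.* n !
      ∎
    where
    open CommutativeSemigroupProperties ℕ.*-commutativeSemigroup using (x∙yz≈y∙xz)
    as : List (List ℕ)
    as = arrangements n (decrement m i)
    P′ : ℕ
    P′ = productOfFactorials (decrement m i)

-- Words and their run lengths

encode : List ℕ → Word
encode []       = []
encode (n ∷ ns) = replicate n N ++ E ∷ encode ns

encode-++ : ∀ u v → encode (u ++ v) ≡ encode u ++ encode v
encode-++ []      v = refl
encode-++ (n ∷ u) v =
  trans (cong (λ w → replicate n N ++ E ∷ w) (encode-++ u v))
        (sym (++-assoc (replicate n N) (E ∷ encode u) (encode v)))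

-- Cut after the last east step; the `k` north steps behind it belong to no vertical run.
decode : ∀ w → ∃₂ λ ns k → w ≡ encode ns ++ replicate k N
decode []      = [] , 0 , refl
decode (E ∷ w) with decode w
... | ns , k , refl = 0 ∷ ns , k , refl
decode (N ∷ w) with decode w
... | []     , k , refl = [] , suc k , refl
... | n ∷ ns , k , refl = suc n ∷ ns , k , refl

firstRun-injective : ∀ n n′ {w w′} → replicate n N ++ E ∷ w ≡ replicate n′ N ++ E ∷ w′ →
  n ≡ n′ × w ≡ w′
firstRun-injective zero    zero     refl = refl , refl
firstRun-injective (suc n) (suc n′) eq   =
  Product.map₁ (cong suc) (firstRun-injective n n′ (∷-injectiveʳ eq))

-- A prefix that is itself an encoding stops at a boundary between runs, so the cut comes from a cut
-- of the list.
encode-prefix : ∀ u {w} ns → encode u ++ w ≡ encode ns → ∃ λ v → ns ≡ u ++ v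
encode-prefix []      ns        eq = ns , refl
encode-prefix (n ∷ u) []        eq with () ← ++-conicalʳ (replicate n N) _
  (trans (sym (++-assoc (replicate n N) _ _)) eq)
encode-prefix (n ∷ u) (n′ ∷ ns) eq
  with refl , eq′ ← firstRun-injective n n′ (trans (sym (++-assoc (replicate n N) _ _)) eq)
  with v , refl ← encode-prefix u ns eq′ = v , refl

encode-injective : ∀ u v → encode u ≡ encode v → u ≡ v
encode-injective []       []       eq = refl
encode-injective []       (n ∷ ns) eq with () ← ++-conicalʳ (replicate n N) _ (sym eq)
encode-injective (n ∷ ns) []       eq with () ← ++-conicalʳ (replicate n N) _ eq
encode-injective (n ∷ u)  (n′ ∷ v) eq with refl , eq′ ← firstRun-injective n n′ eq =
  cong (n ∷_) (encode-injective u v eq′)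

#-++ : ∀ s u v → (# s) (u ++ v) ≡ (# s) u + (# s) v
#-++ s u v = trans (cong length (filter-++ (s ≟_) u v)) (length-++ (filter (s ≟_) u))

#N-replicate : ∀ k → (# N) (replicate k N) ≡ k
#N-replicate zero    = refl
#N-replicate (suc k) = cong suc (#N-replicate k)

#E-replicate : ∀ k → (# E) (replicate k N) ≡ 0
#E-replicate zero    = refl
#E-replicate (suc k) = #E-replicate k

#N-encode : ∀ ns → (# N) (encode ns) ≡ sum ns
#N-encode []       = refl
#N-encode (n ∷ ns) = trans (#-++ N (replicate n N) (E ∷ encode ns))
  (cong₂ _+_ (#N-replicate n) (#N-encode ns))

#E-encode : ∀ ns → (# E) (encode ns) ≡ length ns
#E-encode []       = refl
#E-encode (n ∷ ns) = trans (#-++ E (replicate n N) (E ∷ encode ns))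
  (cong₂ _+_ (#E-replicate n) (cong suc (#E-encode ns)))

-- Vertical runs of an encoded word

RunStart : Word → Set
RunStart u = u ≡ [] ⊎ last u ≡ just E

firstRun-prefix : ∀ n w → Prefix _≡_ (replicate n N ∷ʳ E) (replicate n N ++ E ∷ w)
firstRun-prefix zero    w = refl ∷ []
firstRun-prefix (suc n) w = refl ∷ firstRun-prefix n w

firstRun-unique : ∀ i n w → Prefix _≡_ (replicate i N ∷ʳ E) (replicate n N ++ E ∷ w) → i ≡ n
firstRun-unique zero    zero    w _            = refl
firstRun-unique zero    (suc n) w (() ∷ _)
firstRun-unique (suc i) zero    w (() ∷ _)
firstRun-unique (suc i) (suc n) w (refl ∷ pre) = cong suc (firstRun-unique i n w pre)

-- The factorisations of `u ++ w` whose cut lies in `w`; keeping the part `u` already read makes an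
-- induction along the word possible.
factorisations : Word → Word → List (Word × Word)
factorisations u w = zip (map (u ++_) (inits w)) (tails w)

runsAfter : ℕ → Word → Word → ℕ
runsAfter i u w = length (filter (verticalRunAt? i) (factorisations u w))

verticalRuns≡runsAfter-[] : ∀ i w → verticalRuns i w ≡ runsAfter i [] w
verticalRuns≡runsAfter-[] i w =
  cong (λ us → length (filter (verticalRunAt? i) (zip us (tails w)))) (sym (map-id (inits w)))

factorisations-∷ : ∀ u x w →
  factorisations u (x ∷ w) ≡ (u , x ∷ w) ∷ factorisations (u ∷ʳ x) w
factorisations-∷ u x w = cong₂ _∷_ (cong (_, x ∷ w) (++-identityʳ u))
  (cong (λ us → zip us (tails w)) (trans (sym (map-∘ (inits w)))
    (map-cong (λ v → sym (++-assoc u [ x ] v)) (inits w))))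

runsAfter-accept : ∀ i u x w → VerticalRunAt i (u , x ∷ w) →
  runsAfter i u (x ∷ w) ≡ suc (runsAfter i (u ∷ʳ x) w)
runsAfter-accept i u x w run = cong length
  (trans (cong (filter (verticalRunAt? i)) (factorisations-∷ u x w))
         (filter-accept (verticalRunAt? i) {xs = factorisations (u ∷ʳ x) w} run))

runsAfter-reject : ∀ i u x w → ¬ VerticalRunAt i (u , x ∷ w) →
  runsAfter i u (x ∷ w) ≡ runsAfter i (u ∷ʳ x) w
runsAfter-reject i u x w ¬run = cong length
  (trans (cong (filter (verticalRunAt? i)) (factorisations-∷ u x w))
         (filter-reject (verticalRunAt? i) {xs = factorisations (u ∷ʳ x) w} ¬run))

¬RunStart-∷ʳN : ∀ u → ¬ RunStart (u ∷ʳ N)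
¬RunStart-∷ʳN u (inj₁ eq) with () ← ++-conicalʳ u _ eq
¬RunStart-∷ʳN u (inj₂ eq) with () ← trans (sym (last-∷ʳ u N)) eq

RunStart-∷ʳE : ∀ u → RunStart (u ∷ʳ E)
RunStart-∷ʳE u = inj₂ (last-∷ʳ u E)

-- At a run start exactly one length matches, that of the first run. The first letter `x` is left
-- open since it is `E` for an empty run and `N` otherwise.
runsAfter-firstRun : ∀ i u {n ns} x w → x ∷ w ≡ encode (n ∷ ns) → RunStart u →
  runsAfter i (u ∷ʳ x) w ≡ occurrences i ns → runsAfter i u (x ∷ w) ≡ occurrences i (n ∷ ns)
runsAfter-firstRun i u {n} {ns} x w eq start ih with i ℕ.≟ n
... | yes refl = trans (runsAfter-accept n u x w (start , subst (Prefix _≡_ _) (sym eq) (firstRun-prefix n _)))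
  (trans (cong suc ih) (sym (occurrences-here n ns)))
... | no  i≢n  = trans (runsAfter-reject i u x w (i≢n ∘ firstRun-unique i n _ ∘ subst (Prefix _≡_ _) eq ∘ proj₂))
  (trans ih (sym (occurrences-there ns i≢n)))

-- A cut right after a north step is never a run start, so the cuts inside a run count for nothing.
-- Of `u′` it only matters later that an `E` follows it.
runsAfter-skip : ∀ i k u w → ∃ λ u′ →
  runsAfter i (u ∷ʳ N) (replicate k N ++ E ∷ w) ≡ runsAfter i (u′ ∷ʳ E) w
runsAfter-skip i zero    u w = u ∷ʳ N , runsAfter-reject i (u ∷ʳ N) E w (¬RunStart-∷ʳN u ∘ proj₁)
runsAfter-skip i (suc k) u w with u′ , eq ← runsAfter-skip i k (u ∷ʳ N) w =
  u′ , trans (runsAfter-reject i (u ∷ʳ N) N _ (¬RunStart-∷ʳN u ∘ proj₁)) eq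

runsAfter-encode : ∀ i ns u → RunStart u → runsAfter i u (encode ns) ≡ occurrences i ns
runsAfter-encode i [] u start =
  cong length (filter-reject (verticalRunAt? i) {u ++ [] , []} {[]} (¬prefix i ∘ proj₂))
  where
  ¬prefix : ∀ i → ¬ Prefix _≡_ (replicate i N ∷ʳ E) []
  ¬prefix zero    ()
  ¬prefix (suc i) ()
runsAfter-encode i (zero ∷ ns) u start = runsAfter-firstRun i u E (encode ns) refl start
  (runsAfter-encode i ns (u ∷ʳ E) (RunStart-∷ʳE u))
runsAfter-encode i (suc n ∷ ns) u start = runsAfter-firstRun i u N _ refl start
  (let u′ , eq = runsAfter-skip i n u (encode ns)
   in trans eq (runsAfter-encode i ns (u′ ∷ʳ E) (RunStart-∷ʳE u′)))

verticalRuns-encode : ∀ i ns → verticalRuns i (encode ns) ≡ occurrences i ns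
verticalRuns-encode i ns =
  trans (verticalRuns≡runsAfter-[] i (encode ns)) (runsAfter-encode i ns [] (inj₁ refl))

-- Dyck paths

AboveLine : ℕ → ℕ → Word → Set
AboveLine a b w = All (λ u → a ℕ.* (# E) u ≤ b ℕ.* (# N) u) (inits w)

module _ (a b : ℕ) where

  -- This is `b` times the signed height of the end of `encode ns` above the line.
  excess : List ℕ → ℤ
  excess ns = + (b ℕ.* sum ns) ℤ.- + (a ℕ.* length ns)

  excess-++ : ∀ u v → excess (u ++ v) ≡ excess u ℤ.+ excess v
  excess-++ u v = begin
    + (b ℕ.* sum (u ++ v)) ℤ.- + (a ℕ.* length (u ++ v))
      ≡⟨ cong₂ (λ s l → + s ℤ.- + l)
           (trans (cong (b ℕ.*_) (sum-++ u v)) (ℕ.*-distribˡ-+ b (sum u) (sum v)))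
           (trans (cong (a ℕ.*_) (length-++ u)) (ℕ.*-distribˡ-+ a (length u) (length v))) ⟩
    (+ su ℤ.+ + sv) ℤ.- (+ lu ℤ.+ + lv)
      ≡⟨ cong (ℤ._+_ (+ su ℤ.+ + sv)) (ℤ.neg-distrib-+ (+ lu) (+ lv)) ⟩
    (+ su ℤ.+ + sv) ℤ.+ (ℤ.- + lu ℤ.+ ℤ.- + lv)
      ≡⟨ interchange (+ su) (+ sv) (ℤ.- + lu) (ℤ.- + lv) ⟩
    excess u ℤ.+ excess v
      ∎
    where
    open ≡-Reasoning
    open CommutativeSemigroupProperties ℤ.+-commutativeSemigroup using (interchange)
    su sv lu lv : ℕ
    su = b ℕ.* sum u
    sv = b ℕ.* sum v
    lu = a ℕ.* length u
    lv = a ℕ.* length v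

  encode-AboveLine⁻ : ∀ ns → AboveLine a b (encode ns) → NonNegative excess ns
  encode-AboveLine⁻ ns above u v refl = ℤ.i≤j⇒0≤j-i (ℤ.+≤+ (subst₂ (λ e n → a ℕ.* e ≤ b ℕ.* n)
    (#E-encode u) (#N-encode u)
    (All.lookup above (subst (λ w → encode u ∈ inits w) (sym (encode-++ u v)) (∈-inits⁺ (encode u))))))

  -- Any prefix of the word is some `encode u` followed by north steps. These only lead away from
  -- the line, so the condition at the end of `encode u` suffices.
  encode-AboveLine⁺ : ∀ ns → NonNegative excess ns → AboveLine a b (encode ns)
  encode-AboveLine⁺ ns nonNeg = All.tabulate λ {p} p∈ → above p (∈-inits⁻ (encode ns) p∈)
    where
    above : ∀ p → (∃ λ q → encode ns ≡ p ++ q) → a ℕ.* (# E) p ≤ b ℕ.* (# N) p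
    above p (q , eq) with decode p
    ... | u , k , refl
      with v , refl ← encode-prefix u ns (trans (sym (++-assoc (encode u) (replicate k N) q)) (sym eq)) = begin
      a ℕ.* (# E) (encode u ++ replicate k N)                 ≡⟨ cong (a ℕ.*_) (#-++ E (encode u) _) ⟩
      a ℕ.* ((# E) (encode u) + (# E) (replicate k N))        ≡⟨ cong₂ (λ x y → a ℕ.* (x + y)) (#E-encode u) (#E-replicate k) ⟩
      a ℕ.* (length u + 0)                                    ≡⟨ cong (a ℕ.*_) (ℕ.+-identityʳ (length u)) ⟩
      a ℕ.* length u                                          ≤⟨ ℤ.drop‿+≤+ (ℤ.0≤i-j⇒j≤i (nonNeg u v refl)) ⟩
      b ℕ.* sum u                                             ≤⟨ ℕ.*-monoʳ-≤ b (ℕ.m≤m+n (sum u) _) ⟩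
      b ℕ.* (sum u + (# N) (replicate k N))                   ≡⟨ cong (λ x → b ℕ.* (x + _)) (#N-encode u) ⟨
      b ℕ.* ((# N) (encode u) + (# N) (replicate k N))        ≡⟨ cong (b ℕ.*_) (#-++ N (encode u) _) ⟨
      b ℕ.* (# N) (encode u ++ replicate k N)                 ∎
      where open ℕ.≤-Reasoning

  -- If north steps followed the last east step, then just before them the path would be at abscissa
  -- `b` and height below `a`, hence under the line.
  IsDyckPath⇒encode : .{{_ : NonZero b}} → ∀ {w} → IsDyckPath a b w → ∃ λ ns → w ≡ encode ns
  IsDyckPath⇒encode {w} dyck with decode w
  ... | ns , zero  , w≡ = ns , trans w≡ (++-identityʳ (encode ns))
  ... | ns , suc k , refl = contradiction a≤sum (ℕ.<⇒≱ sum<a)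
    where
    open IsDyckPath dyck
    length≡b : length ns ≡ b
    length≡b = begin
      length ns                                                   ≡⟨ ℕ.+-identityʳ (length ns) ⟨
      length ns + 0                                               ≡⟨ cong₂ _+_ (#E-encode ns) (#E-replicate (suc k)) ⟨
      (# E) (encode ns) + (# E) (replicate (suc k) N)             ≡⟨ #-++ E (encode ns) _ ⟨
      (# E) (encode ns ++ replicate (suc k) N)                    ≡⟨ eastSteps ⟩
      b                                                           ∎
      where open ≡-Reasoning

    sum<a : sum ns < a
    sum<a = begin-strict
      sum ns                                                      <⟨ ℕ.m<m+n (sum ns) (s≤s z≤n) ⟩
      sum ns + suc k                                              ≡⟨ cong₂ _+_ (#N-encode ns) (#N-replicate (suc k)) ⟨
      (# N) (encode ns) + (# N) (replicate (suc k) N)             ≡⟨ #-++ N (encode ns) _ ⟨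
      (# N) (encode ns ++ replicate (suc k) N)                    ≡⟨ northSteps ⟩
      a                                                           ∎
      where open ℕ.≤-Reasoning

    a≤sum : a ≤ sum ns
    a≤sum = ℕ.*-cancelˡ-≤ b (begin
      b ℕ.* a                    ≡⟨ ℕ.*-comm b a ⟩
      a ℕ.* b                    ≡⟨ cong (a ℕ.*_) (trans (#E-encode ns) length≡b) ⟨
      a ℕ.* (# E) (encode ns)    ≤⟨ All.lookup aboveLine (∈-inits⁺ (encode ns)) ⟩
      b ℕ.* (# N) (encode ns)    ≡⟨ cong (b ℕ.*_) (#N-encode ns) ⟩
      b ℕ.* sum ns               ∎)
      where open ℕ.≤-Reasoning

  -- Weight 0 makes `b` divide `a ℕ.* length u`, hence `length u` by coprimality. A nonempty `u`
  -- then has length at least `b` and leaves nothing for `v`.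
  excess≡0⇒trivial : .{{_ : NonZero b}} → Coprime a b → ∀ u v → length (u ++ v) ≡ b →
    excess u ≡ 0ℤ → u ≡ [] ⊎ v ≡ []
  excess≡0⇒trivial a⊥b []         v len eq = inj₁ refl
  excess≡0⇒trivial a⊥b u@(_ ∷ u′) v len eq = inj₂ (length≡0⇒≡[] (ℕ.n≤0⇒n≡0
    (ℕ.+-cancelˡ-≤ (length u) _ _ (begin
      length u + length v    ≡⟨ length-++ u ⟨
      length (u ++ v)        ≡⟨ len ⟩
      b                      ≤⟨ ∣⇒≤ b∣length ⟩
      length u               ≡⟨ ℕ.+-identityʳ (length u) ⟨
      length u + 0           ∎))))
    where
    open ℕ.≤-Reasoning
    b∣length : b ∣ length u
    b∣length = coprime-divisor (Coprimality.sym a⊥b) (divides (sum u)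
      (trans (sym (ℤ.+-injective (ℤ.i-j≡0⇒i≡j _ _ eq))) (ℕ.*-comm b (sum u))))

-- Counting the Dyck paths with given runs

All-≤sum : ∀ ns → All (_≤ sum ns) ns
All-≤sum []       = []
All-≤sum (n ∷ ns) = ℕ.m≤m+n n (sum ns) ∷ All.map (λ le → ℕ.≤-trans le (ℕ.m≤n+m (sum ns) n)) (All-≤sum ns)

!-pred : ∀ b .{{_ : NonZero b}} → b ! ≡ b ℕ.* (b ∸ 1) !
!-pred (suc b) = refl

module _ (a b : ℕ) .{{_ : NonZero b}} (a⊥b : Coprime a b) (m : Fin (suc a) → ℕ)
  (Σim≡a : sumFin (λ i → toℕ i ℕ.* m i) ≡ a) (Σm≡b : sumFin m ≡ b) where

  -- The filter tests the encoded word, where the condition is a finite check, instead of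
  -- `NonNegative`, which quantifies over all factorisations.
  dyckRunLengths : List (List ℕ)
  dyckRunLengths =
    filter (λ ns → all? (λ u → a ℕ.* (# E) u ℕ.≤? b ℕ.* (# N) u) (inits (encode ns))) (arrangements b m)

  dyckPaths : List Word
  dyckPaths = map encode dyckRunLengths

  dyckPaths! : Unique dyckPaths
  dyckPaths! = Unique.map⁺ (encode-injective _ _) (Unique.filter⁺ _ (arrangements! b m))

  ∈-dyckRunLengths : ∀ ns → ns ∈ dyckRunLengths ⇔ (Content m ns × NonNegative (excess a b) ns)
  ∈-dyckRunLengths ns = mk⇔
    (λ ns∈ → let ns∈′ , above = ∈-filter⁻ _ ns∈
             in ∈-arrangements⁻ b m Σm≡b ns∈′ , encode-AboveLine⁻ a b ns above)
    (λ (c , nonNeg) → ∈-filter⁺ _ (∈-arrangements⁺ b m Σm≡b c) (encode-AboveLine⁺ a b ns nonNeg))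

  ∈-dyckPaths : ∀ w → w ∈ dyckPaths ⇔ DyckPathWithRuns a b m w
  ∈-dyckPaths w = mk⇔ to from
    where
    to : w ∈ dyckPaths → DyckPathWithRuns a b m w
    to w∈ with ns , ns∈ , refl ← ∈-map⁻ encode w∈
          with c , nonNeg ← Equivalence.to (∈-dyckRunLengths ns) ns∈ =
      record
        { northSteps = trans (#N-encode ns) (trans (Content-sum c) Σim≡a)
        ; eastSteps  = trans (#E-encode ns) (trans (Content-length c) Σm≡b)
        ; aboveLine  = encode-AboveLine⁺ a b ns nonNeg
        } , λ i → trans (verticalRuns-encode (toℕ i) ns) (proj₂ c i)

    from : DyckPathWithRuns a b m w → w ∈ dyckPaths
    from (dyck , runs) with ns , refl ← IsDyckPath⇒encode a b dyck =
      ∈-map⁺ encode (Equivalence.from (∈-dyckRunLengths ns)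
        -- No run is longer than the total number `a` of north steps, so every entry is below
        -- `suc a`.
        ( ( All.map (λ le → s≤s (subst (_ ≤_) (trans (sym (#N-encode ns)) northSteps) le)) (All-≤sum ns)
          , λ i → trans (sym (verticalRuns-encode (toℕ i) ns)) (runs i) )
        , encode-AboveLine⁻ a b ns aboveLine ))
      where open IsDyckPath dyck

  length-arrangements≡b*dyckPaths : length (arrangements b m) ≡ b ℕ.* length dyckPaths
  length-arrangements≡b*dyckPaths = trans
    (length≡n*nonNegatives (λ c → trans (Content-length c) Σm≡b) excess≡0 Content-rotate
      (λ u v c → excess≡0⇒trivial a b a⊥b u v (trans (Content-length c) Σm≡b))
      (arrangements! b m)
      (λ ns → mk⇔ (∈-arrangements⁻ b m Σm≡b) (∈-arrangements⁺ b m Σm≡b))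
      (Unique.filter⁺ _ (arrangements! b m)) ∈-dyckRunLengths (ℕ.>-nonZero⁻¹ b))
    (cong (b ℕ.*_) (sym (length-map encode dyckRunLengths)))
    where
    open CycleLemma (excess a b) (excess-++ a b)
    excess≡0 : ∀ {ns} → Content m ns → excess a b ns ≡ 0ℤ
    excess≡0 {ns} c = ℤ.i≡j⇒i-j≡0 (cong +_ (begin
      b ℕ.* sum ns       ≡⟨ cong (b ℕ.*_) (trans (Content-sum c) Σim≡a) ⟩
      b ℕ.* a            ≡⟨ ℕ.*-comm b a ⟩
      a ℕ.* b            ≡⟨ cong (a ℕ.*_) (trans (Content-length c) Σm≡b) ⟨
      a ℕ.* length ns    ∎))
      where open ≡-Reasoning

  -- Multiplied by `b`, the left side counts all arrangements and becomes `b !`; then `b` is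
  -- cancelled.
  length-dyckPaths : length dyckPaths ℕ.* productOfFactorials m ≡ (b ∸ 1) !
  length-dyckPaths = ℕ.*-cancelˡ-≡ _ _ b (begin
    b ℕ.* (length dyckPaths ℕ.* productOfFactorials m)    ≡⟨ ℕ.*-assoc b (length dyckPaths) _ ⟨
    b ℕ.* length dyckPaths ℕ.* productOfFactorials m      ≡⟨ cong (ℕ._* productOfFactorials m) length-arrangements≡b*dyckPaths ⟨
    length (arrangements b m) ℕ.* productOfFactorials m   ≡⟨ length-arrangements b m Σm≡b ⟩
    b !                                                   ≡⟨ !-pred b ⟩
    b ℕ.* (b ∸ 1) !                                       ∎)
    where
    open ≡-Reasoning

-- The count as a rational number

/-cong-* : ∀ p q r s .{{_ : NonZero q}} .{{_ : NonZero s}} →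
  p ℕ.* s ≡ r ℕ.* q → + p / q ≡ + r / s
/-cong-* p (suc q) r (suc s) eq = ℚ.fromℚᵘ-cong {ℚᵘ.mkℚᵘ (+ p) q} {ℚᵘ.mkℚᵘ (+ r) s} (ℚᵘ.*≡*
  (trans (sym (ℤ.pos-* p (suc s))) (trans (cong +_ eq) (ℤ.pos-* r (suc q)))))

-- Since `_/_` reduces to lowest terms, the comparison is made among unnormalised rationals, where
-- numerators and denominators simply multiply.
*-/-homo : ∀ p q r s .{{_ : NonZero q}} .{{_ : NonZero s}} →
  (+ p / q) * (+ r / s) ≡ (+ (p ℕ.* r) / (q ℕ.* s)) {{ℕ.m*n≢0 q s}}
*-/-homo p (suc q) r (suc s) = ℚ.toℚᵘ-injective (begin-equality
  ℚ.toℚᵘ (x * y)                                    ≃⟨ ℚ.toℚᵘ-homo-* x y ⟩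
  ℚ.toℚᵘ x ℚᵘ.* ℚ.toℚᵘ y                            ≃⟨ ℚᵘ.*-cong (ℚ.toℚᵘ-fromℚᵘ (ℚᵘ.mkℚᵘ (+ p) q)) (ℚ.toℚᵘ-fromℚᵘ (ℚᵘ.mkℚᵘ (+ r) s)) ⟩
  ℚᵘ.mkℚᵘ (+ p) q ℚᵘ.* ℚᵘ.mkℚᵘ (+ r) s              ≡⟨ cong (λ n → ℚᵘ.mkℚᵘ n (s + q ℕ.* suc s)) (sym (ℤ.pos-* p r)) ⟩
  ℚᵘ.mkℚᵘ (+ (p ℕ.* r)) (s + q ℕ.* suc s)           ≃⟨ ℚ.toℚᵘ-fromℚᵘ (ℚᵘ.mkℚᵘ (+ (p ℕ.* r)) (s + q ℕ.* suc s)) ⟨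
  ℚ.toℚᵘ (+ (p ℕ.* r) / (suc q ℕ.* suc s))          ∎)
  where
  open ℚᵘ.≤-Reasoning
  x y : ℚ
  x = + p / suc q
  y = + r / suc s

1/b*multinomial : ∀ b .{{_ : NonZero b}} {n} (m : Fin n → ℕ) →
  (+ 1 / b) * multinomial b m ≡ (+ ((b ∸ 1) !) / productOfFactorials m) {{productOfFactorials≢0 m}}
1/b*multinomial b m = trans (*-/-homo 1 b (b !) P)
  (/-cong-* (1 ℕ.* b !) (b ℕ.* P) ((b ∸ 1) !) P {{ℕ.m*n≢0 b P}} (begin
    1 ℕ.* b ! ℕ.* P              ≡⟨ cong (ℕ._* P) (trans (ℕ.*-identityˡ (b !)) (!-pred b)) ⟩
    b ℕ.* (b ∸ 1) ! ℕ.* P        ≡⟨ cong (ℕ._* P) (ℕ.*-comm b _) ⟩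
    (b ∸ 1) ! ℕ.* b ℕ.* P        ≡⟨ ℕ.*-assoc ((b ∸ 1) !) b P ⟩
    (b ∸ 1) ! ℕ.* (b ℕ.* P)      ∎))
  where
  open ≡-Reasoning
  P : ℕ
  P = productOfFactorials m
  instance
    P≢0 : NonZero P
    P≢0 = productOfFactorials≢0 m

proposition2 : (a b : ℕ) .{{_ : NonZero a}} .{{_ : NonZero b}} → Coprime a b →
    (m : Fin (suc a) → ℕ) →
    sumFin (λ i → toℕ i ℕ.* m i) ≡ a → sumFin m ≡ b →
    Σ[ k ∈ ℕ ] HasCardinality (DyckPathWithRuns a b m) k
    × + k / 1 ≡ (+ 1 / b) * multinomial b m
    × (+ 1 / b) * multinomial b m ≡ (+ ((b ℕ.∸ 1) !) / productOfFactorials m) {{productOfFactorials≢0 m}}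
proposition2 a b a⊥b m Σim≡a Σm≡b =
    k
  , (paths , dyckPaths! a b a⊥b m Σim≡a Σm≡b , ∈-dyckPaths a b a⊥b m Σim≡a Σm≡b , refl)
  -- Both sides are compared with the quotient of factorials; for `k` this is `length-dyckPaths`
  -- after cross-multiplication.
  , trans (/-cong-* k 1 ((b ∸ 1) !) (productOfFactorials m) {{_}} {{productOfFactorials≢0 m}}
             (trans (length-dyckPaths a b a⊥b m Σim≡a Σm≡b) (sym (ℕ.*-identityʳ ((b ∸ 1) !)))))
          (sym (1/b*multinomial b m))
  , 1/b*multinomial b m
  where
  paths : List Word
  paths = dyckPaths a b a⊥b m Σim≡a Σm≡b
  k : ℕ
  k = length paths
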